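{- $\mathsf{RCA}_0$ proves the following statement. Let $X$ and $Y$ be sets, and let $\pi : X \to Y$ be a function with $\pi(a) \neq \pi(b)$ for some $a,b \in X$. Then $a$ and $b$ are not connected in the V-space induced by $\pi$.
   Context: $\mathsf{RCA}_0$ is the usual subsystem of second-order arithmetic (recursive comprehension). All notions are formalized in the language of second-order arithmetic: $\omega$ denotes the set of natural numbers (of the model), sets are subsets of it, and sequences of sets are coded by single sets in the usual way. A strong system of vicinities for $x$ in a non-empty set $X \subseteq \omega$ is a sequence $\mathcal{S} = \langle S_n : n \in I\rangle$, where $I$ is a non-empty (possibly finite) initial segment of $\omega$, $x \in S_n \subseteq X$ for all $n \in I$, and $S_n \neq S_m$ for all $n,m \in I$ with $n \neq m$. A strong V-space is a pair $(X,\{\mathcal{S}_x : x \in X\})$, where for each $x \in X$, $\mathcal{S}_x$ is a strong system of vicinities for $x$ in $X$; the terms of $\mathcal{S}_x$ are called the vicinities of $x$. The V-space induced by $\pi : X \to Y$ is the strong V-space on $X$ in which each $x \in X$ has exactly one vicinity, namely $\{y \in X : \pi(x) = \pi(y)\}$. ($\mathsf{RCA}_0$ proves that it exists, given $X$, $Y$ and $\pi$.) A cover of a V-space is a sequence $\langle V_x : x \in X\rangle$ such that $V_x$ is a vicinity of $x$ for each $x \in X$. Two elements $a,b \in X$ are connected in the V-space if for every cover $\langle V_x : x \in X\rangle$ there is a finite sequence $x_0,\ldots,x_k$ of elements of $X$ such that $a = x_0$, $b = x_k$, and $V_{x_j} \cap V_{x_{j+1}} \neq \emptyset$ for each $j <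 k$. -}

module Defs where

open import Data.Fin.Base using (Fin; zero; suc)
open import Data.Fin.Patterns using (0F; 1F; 2F; 3F)
open import Data.List.Base using (List; []; _∷_; map)
import Data.List.Membership.Propositional as List
open import Data.Nat.Base as ℕ using (ℕ)
open import Function.Base using (id; _∘_)

------------------------------------------------------------------------
-- The language of second-order arithmetic

infix  20 ↑_ ↑[_]_
infixl 15 _*_
infixl 14 _+_
infix  12 _≈_ _<_ _∈_ _∣_ _∈ᶠ_ _∈_⟦_⟧ _at_is_
infix  11 ¬_
infixr 10 _∧_
infixr  9 _∨_
infixr  8 _⇒_
infix   7 _⇔_
infixr  6 ∀ⁿ_ ∃ⁿ_ ∀ˢ_ ∃ˢ_

private variable
  n n′ m m′ : ℕ

-- De Bruijn syntax.  A term has n free number variables; a formula has n free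
-- number variables and, indexed separately, m free set variables.  The only
-- terms of set sort are variables.

data Term (n : ℕ) : Set where
  var     : Fin n → Term n
  𝟎 𝟏     : Term n
  _+_ _*_ : Term n → Term n → Term n

data Formula (n m : ℕ) : Set where
  _≈_ _<_     : Term n → Term n → Formula n m
  _∈_         : Term n → Fin m → Formula n m
  ⊥           : Formula n m
  _∧_ _∨_ _⇒_ : Formula n m → Formula n m → Formula n m
  ∀ⁿ_ ∃ⁿ_     : Formula (ℕ.suc n) m → Formula n m
  ∀ˢ_ ∃ˢ_     : Formula n (ℕ.suc m) → Formula n m

Sentence : Set
Sentence = Formula 0 0

¬_ : Formula n m → Formula n m
¬ φ = φ ⇒ ⊥

_⇔_ : Formula n m → Formula n m → Formula n m
φ ⇔ ψ = (φ ⇒ ψ) ∧ (ψ ⇒ φ)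

------------------------------------------------------------------------
-- Simultaneous substitution of terms for number variables and of set
-- variables for set variables

subT : (Fin n → Term n′) → Term n → Term n′
subT σ (var i) = σ i
subT σ 𝟎       = 𝟎
subT σ 𝟏       = 𝟏
subT σ (t + u) = subT σ t + subT σ u
subT σ (t * u) = subT σ t * subT σ u

↑_ : Term n → Term (ℕ.suc n)
↑_ = subT (var ∘ suc)

↑[_]_ : (k : ℕ) → Term n → Term (k ℕ.+ n)
↑[ ℕ.zero  ] t = t
↑[ ℕ.suc k ] t = ↑ (↑[ k ] t)

liftⁿ : (Fin n → Term n′) → Fin (ℕ.suc n) → Term (ℕ.suc n′)
liftⁿ σ zero    = var zero
liftⁿ σ (suc i) = ↑ (σ i)

liftˢ : (Fin m → Fin m′) → Fin (ℕ.suc m) → Fin (ℕ.suc m′)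
liftˢ ρ zero    = zero
liftˢ ρ (suc i) = suc (ρ i)

sub : (Fin n → Term n′) → (Fin m → Fin m′) → Formula n m → Formula n′ m′
sub σ ρ (t ≈ u) = subT σ t ≈ subT σ u
sub σ ρ (t < u) = subT σ t < subT σ u
sub σ ρ (t ∈ X) = subT σ t ∈ ρ X
sub σ ρ ⊥       = ⊥
sub σ ρ (φ ∧ ψ) = sub σ ρ φ ∧ sub σ ρ ψ
sub σ ρ (φ ∨ ψ) = sub σ ρ φ ∨ sub σ ρ ψ
sub σ ρ (φ ⇒ ψ) = sub σ ρ φ ⇒ sub σ ρ ψ
sub σ ρ (∀ⁿ φ)  = ∀ⁿ sub (liftⁿ σ) ρ φ
sub σ ρ (∃ⁿ φ)  = ∃ⁿ sub (liftⁿ σ) ρ φ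
sub σ ρ (∀ˢ φ)  = ∀ˢ sub σ (liftˢ ρ) φ
sub σ ρ (∃ˢ φ)  = ∃ˢ sub σ (liftˢ ρ) φ

wkⁿ : Formula n m → Formula (ℕ.suc n) m
wkⁿ = sub (var ∘ suc) id

wkˢ : Formula n m → Formula n (ℕ.suc m)
wkˢ = sub var suc

instⁿ : Term n → Fin (ℕ.suc n) → Term n
instⁿ t zero    = t
instⁿ t (suc i) = var i

instˢ : Fin m → Fin (ℕ.suc m) → Fin m
instˢ X zero    = X
instˢ X (suc i) = i

_[_]ⁿ : Formula (ℕ.suc n) m → Term n → Formula n m
φ [ t ]ⁿ = sub (instⁿ t) id φ

_[_]ˢ : Formula n (ℕ.suc m) → Fin m → Formula n m
φ [ X ]ˢ = sub var (instˢ X) φ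

-- φ(x) ↦ φ(x+1), for x the variable 0F.
_[x+1] : Formula (ℕ.suc n) m → Formula (ℕ.suc n) m
φ [x+1] = sub (λ { zero → var zero + 𝟏 ; (suc i) → var (suc i) }) id φ

------------------------------------------------------------------------
-- Classical two-sorted natural deduction over a theory.  Axioms may have free
-- variables (parameters) and then stand for their universal closures.

Theory : Set₁
Theory = ∀ {n m} → Formula n m → Set

data Derivation (T : Theory) {n m : ℕ} (Γ : List (Formula n m)) :
                Formula n m → Set where
  axiom : ∀ {φ} → T φ → Derivation T Γ φ
  hyp   : ∀ {φ} → φ List.∈ Γ → Derivation T Γ φ

  ⇒I  : ∀ {φ ψ} → Derivation T (φ ∷ Γ) ψ → Derivation T Γ (φ ⇒ ψ)
  ⇒E  : ∀ {φ ψ} → Derivation T Γ (φ ⇒ ψ) → Derivation T Γ φ → Derivation T Γ ψ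
  ∧I  : ∀ {φ ψ} → Derivation T Γ φ → Derivation T Γ ψ → Derivation T Γ (φ ∧ ψ)
  ∧E₁ : ∀ {φ ψ} → Derivation T Γ (φ ∧ ψ) → Derivation T Γ φ
  ∧E₂ : ∀ {φ ψ} → Derivation T Γ (φ ∧ ψ) → Derivation T Γ ψ
  ∨I₁ : ∀ {φ ψ} → Derivation T Γ φ → Derivation T Γ (φ ∨ ψ)
  ∨I₂ : ∀ {φ ψ} → Derivation T Γ ψ → Derivation T Γ (φ ∨ ψ)
  ∨E  : ∀ {φ ψ χ} → Derivation T Γ (φ ∨ ψ) →
        Derivation T (φ ∷ Γ) χ → Derivation T (ψ ∷ Γ) χ → Derivation T Γ χ
  raa : ∀ {φ} → Derivation T (¬ φ ∷ Γ) ⊥ → Derivation T Γ φ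

  ∀ⁿI : ∀ {φ} → Derivation T (map wkⁿ Γ) φ → Derivation T Γ (∀ⁿ φ)
  ∀ⁿE : ∀ {φ} → Derivation T Γ (∀ⁿ φ) → (t : Term n) → Derivation T Γ (φ [ t ]ⁿ)
  ∃ⁿI : ∀ {φ} (t : Term n) → Derivation T Γ (φ [ t ]ⁿ) → Derivation T Γ (∃ⁿ φ)
  ∃ⁿE : ∀ {φ χ} → Derivation T Γ (∃ⁿ φ) →
        Derivation T (φ ∷ map wkⁿ Γ) (wkⁿ χ) → Derivation T Γ χ

  ∀ˢI : ∀ {φ} → Derivation T (map wkˢ Γ) φ → Derivation T Γ (∀ˢ φ)
  ∀ˢE : ∀ {φ} → Derivation T Γ (∀ˢ φ) → (X : Fin m) → Derivation T Γ (φ [ X ]ˢ)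
  ∃ˢI : ∀ {φ} (X : Fin m) → Derivation T Γ (φ [ X ]ˢ) → Derivation T Γ (∃ˢ φ)
  ∃ˢE : ∀ {φ χ} → Derivation T Γ (∃ˢ φ) →
        Derivation T (φ ∷ map wkˢ Γ) (wkˢ χ) → Derivation T Γ χ

  ≈-refl  : ∀ {t} → Derivation T Γ (t ≈ t)
  ≈-subst : ∀ {t u} φ → Derivation T Γ (t ≈ u) →
            Derivation T Γ (φ [ t ]ⁿ) → Derivation T Γ (φ [ u ]ⁿ)

infix 2 _⊢_

_⊢_ : Theory → Sentence → Set
T ⊢ φ = Derivation T [] φ

------------------------------------------------------------------------
-- RCA₀

-- Bounds are of the form ↑ t because they may not mention the bound variable.
data Δ₀ {n m : ℕ} : Formula n m → Set where
  ≈-Δ₀ : ∀ {t u} → Δ₀ (t ≈ u)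
  <-Δ₀ : ∀ {t u} → Δ₀ (t < u)
  ∈-Δ₀ : ∀ {t X} → Δ₀ (t ∈ X)
  ⊥-Δ₀ : Δ₀ ⊥
  ∧-Δ₀ : ∀ {φ ψ} → Δ₀ φ → Δ₀ ψ → Δ₀ (φ ∧ ψ)
  ∨-Δ₀ : ∀ {φ ψ} → Δ₀ φ → Δ₀ ψ → Δ₀ (φ ∨ ψ)
  ⇒-Δ₀ : ∀ {φ ψ} → Δ₀ φ → Δ₀ ψ → Δ₀ (φ ⇒ ψ)
  ∀-Δ₀ : ∀ {φ} (t : Term n) → Δ₀ φ → Δ₀ (∀ⁿ (var 0F < ↑ t ⇒ φ))
  ∃-Δ₀ : ∀ {φ} (t : Term n) → Δ₀ φ → Δ₀ (∃ⁿ (var 0F < ↑ t ∧ φ))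

data Σ₁ {n m : ℕ} : Formula n m → Set where
  ∃Δ₀ : ∀ {φ} → Δ₀ φ → Σ₁ (∃ⁿ φ)

data Π₁ {n m : ℕ} : Formula n m → Set where
  ∀Δ₀ : ∀ {φ} → Δ₀ φ → Π₁ (∀ⁿ φ)

data RCA₀ {n m : ℕ} : Formula n m → Set where
  suc≉0   : RCA₀ (∀ⁿ ¬ (var 0F + 𝟏 ≈ 𝟎))
  suc-inj : RCA₀ (∀ⁿ ∀ⁿ (var 1F + 𝟏 ≈ var 0F + 𝟏 ⇒ var 1F ≈ var 0F))
  +-zero  : RCA₀ (∀ⁿ (var 0F + 𝟎 ≈ var 0F))
  +-suc   : RCA₀ (∀ⁿ ∀ⁿ (var 1F + (var 0F + 𝟏) ≈ (var 1F + var 0F) + 𝟏))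
  *-zero  : RCA₀ (∀ⁿ (var 0F * 𝟎 ≈ 𝟎))
  *-suc   : RCA₀ (∀ⁿ ∀ⁿ (var 1F * (var 0F + 𝟏) ≈ var 1F * var 0F + var 1F))
  ≮0      : RCA₀ (∀ⁿ ¬ (var 0F < 𝟎))
  <-suc   : RCA₀ (∀ⁿ ∀ⁿ (var 1F < var 0F + 𝟏 ⇔ var 1F < var 0F ∨ var 1F ≈ var 0F))

  Σ₁-induction : ∀ {φ} → Σ₁ φ →
    RCA₀ (φ [ 𝟎 ]ⁿ ∧ (∀ⁿ (φ ⇒ φ [x+1])) ⇒ (∀ⁿ φ))

  Δ₁-comprehension : ∀ {φ ψ} → Σ₁ φ → Π₁ ψ →
    RCA₀ ((∀ⁿ (φ ⇔ ψ)) ⇒ (∃ˢ ∀ⁿ (var 0F ∈ 0F ⇔ wkˢ φ)))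

------------------------------------------------------------------------
-- Coding

_∣_ : Term n → Term n → Formula n m
t ∣ u = ∃ⁿ (↑ u ≈ ↑ t * var 0F)

-- The pairing function (i,j) ↦ (i+j)² + i, which is injective.
⟨_,_⟩ : Term n → Term n → Term n
⟨ t , u ⟩ = (t + u) * (t + u) + t

-- A sequence of sets is coded by a single set A, whose t-th term is
-- { y : ⟨ y , t ⟩ ∈ A }; the index set is given separately.
_∈_⟦_⟧ : Term n → Fin m → Term n → Formula n m
y ∈ A ⟦ t ⟧ = ⟨ y , t ⟩ ∈ A

-- A finite set is coded by a number ⟨ k , ⟨ p , q ⟩ ⟩, with elements those
-- i < k for which p(i+1)+1 divides q.  RCA₀ proves every finite set has a code.
_∈ᶠ_ : Term n → Term n → Formula n m
i ∈ᶠ s = ∃ⁿ ∃ⁿ ∃ⁿ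
  ( ↑[ 3 ] s ≈ ⟨ k , ⟨ p , q ⟩ ⟩
  ∧ ↑[ 3 ] i < k
  ∧ (p * (↑[ 3 ] i + 𝟏) + 𝟏) ∣ q )
  where
  k = var 2F
  p = var 1F
  q = var 0F

-- s codes a finite sequence of length ℓ, i.e. a finite set of pairs that is a
-- function with domain { i : i < ℓ }.
IsFinSeq : Term n → Term n → Formula n m
IsFinSeq s ℓ =
    (∀ⁿ (var 0F ∈ᶠ ↑ s ⇒ (∃ⁿ ∃ⁿ (var 2F ≈ ⟨ var 1F , var 0F ⟩))))
  ∧ (∀ⁿ ∀ⁿ ∀ⁿ ( ⟨ var 2F , var 1F ⟩ ∈ᶠ ↑[ 3 ] s
              ∧ ⟨ var 2F , var 0F ⟩ ∈ᶠ ↑[ 3 ] s ⇒ var 1F ≈ var 0F))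
  ∧ (∀ⁿ (var 0F < ↑ ℓ ⇔ (∃ⁿ (⟨ var 1F , var 0F ⟩ ∈ᶠ ↑[ 2 ] s))))

-- s(i) = x
_at_is_ : Term n → Term n → Term n → Formula n m
s at i is x = ⟨ i , x ⟩ ∈ᶠ s

IsFunction : (π X Y : Fin m) → Formula n m
IsFunction π X Y =
    (∀ⁿ (var 0F ∈ π ⇒
      (∃ⁿ ∃ⁿ (var 1F ∈ X ∧ var 0F ∈ Y ∧ var 2F ≈ ⟨ var 1F , var 0F ⟩))))
  ∧ (∀ⁿ ∀ⁿ ∀ⁿ ( ⟨ var 2F , var 1F ⟩ ∈ π
              ∧ ⟨ var 2F , var 0F ⟩ ∈ π ⇒ var 1F ≈ var 0F))
  ∧ (∀ⁿ (var 0F ∈ X ⇒ (∃ⁿ (⟨ var 1F , var 0F ⟩ ∈ π))))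

SameValue : Fin m → Term n → Term n → Formula n m
SameValue π t u = ∃ⁿ (⟨ ↑ t , var 0F ⟩ ∈ π ∧ ⟨ ↑ u , var 0F ⟩ ∈ π)

DifferentValues : Fin m → Term n → Term n → Formula n m
DifferentValues π t u = ∃ⁿ ∃ⁿ
  ( ⟨ ↑[ 2 ] t , var 1F ⟩ ∈ π
  ∧ ⟨ ↑[ 2 ] u , var 0F ⟩ ∈ π
  ∧ ¬ (var 1F ≈ var 0F) )

------------------------------------------------------------------------
-- V-spaces

-- A V-space on X is coded by sets I and S.  For x ∈ X the index set of its
-- system of vicinities is I_x = { n : ⟨ n , x ⟩ ∈ I }, and the n-th vicinity,
-- for n ∈ I_x, is S_{x,n} = { y : ⟨ y , ⟨ x , n ⟩ ⟩ ∈ S }.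

-- The (possibly improper) initial segment I_x is non-empty; each S_{x,n}
-- contains x and is a subset of X; and S_{x,n} ≠ S_{x,n′} for n ≠ n′.
IsStrongSystem : (X I S : Fin m) → Term n → Formula n m
IsStrongSystem X I S x =
    (∃ⁿ (var 0F ∈ I ⟦ ↑ x ⟧))
  ∧ (∀ⁿ ∀ⁿ (var 1F ∈ I ⟦ ↑[ 2 ] x ⟧ ∧ var 0F < var 1F ⇒ var 0F ∈ I ⟦ ↑[ 2 ] x ⟧))
  ∧ (∀ⁿ (var 0F ∈ I ⟦ ↑ x ⟧ ⇒
        ↑ x ∈ S ⟦ ⟨ ↑ x , var 0F ⟩ ⟧
      ∧ (∀ⁿ (var 0F ∈ S ⟦ ⟨ ↑[ 2 ] x , var 1F ⟩ ⟧ ⇒ var 0F ∈ X))))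
  ∧ (∀ⁿ ∀ⁿ (var 1F ∈ I ⟦ ↑[ 2 ] x ⟧ ∧ var 0F ∈ I ⟦ ↑[ 2 ] x ⟧ ∧ ¬ (var 1F ≈ var 0F) ⇒
      ¬ (∀ⁿ (var 0F ∈ S ⟦ ⟨ ↑[ 3 ] x , var 2F ⟩ ⟧ ⇔ var 0F ∈ S ⟦ ⟨ ↑[ 3 ] x , var 1F ⟩ ⟧))))

IsStrongVSpace : (X I S : Fin m) → Formula n m
IsStrongVSpace X I S =
    (∃ⁿ (var 0F ∈ X))
  ∧ (∀ⁿ (var 0F ∈ X ⇒ IsStrongSystem X I S (var 0F)))

-- The strong V-space in which every x ∈ X has exactly one vicinity, namely
-- { y ∈ X : π(x) = π(y) }.
IsInducedVSpace : (π X I S : Fin m) → Formula n m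
IsInducedVSpace π X I S =
    IsStrongVSpace X I S
  ∧ (∀ⁿ (var 0F ∈ X ⇒
      (∃ⁿ ( var 0F ∈ I ⟦ var 1F ⟧
          ∧ (∀ⁿ (var 0F ∈ I ⟦ var 2F ⟧ ⇒ var 0F ≈ var 1F))
          ∧ (∀ⁿ ( var 0F ∈ S ⟦ ⟨ var 2F , var 1F ⟩ ⟧
                ⇔ var 0F ∈ X ∧ SameValue π (var 2F) (var 0F)))))))

-- For every x ∈ X, the x-th term of V is S_{x,n} for some n ∈ I_x.
IsCover : (X I S V : Fin m) → Formula n m
IsCover X I S V =
  ∀ⁿ (var 0F ∈ X ⇒
    (∃ⁿ ( var 0F ∈ I ⟦ var 1F ⟧
        ∧ (∀ⁿ (var 0F ∈ V ⟦ var 2F ⟧ ⇔ var 0F ∈ S ⟦ ⟨ var 2F , var 1F ⟩ ⟧)))))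

-- Some finite sequence x₀, …, x_k in X (coded by s, of length k+1) has a = x₀,
-- b = x_k, and V_{x_j} ∩ V_{x_{j+1}} ≠ ∅ for all j < k.
HasChain : (X V : Fin m) → (a b : Term n) → Formula n m
HasChain X V a b = ∃ⁿ ∃ⁿ
  (let s = var 1F
       k = var 0F
   in
     IsFinSeq s (k + 𝟏)
   ∧ (∀ⁿ ∀ⁿ (↑[ 2 ] s at var 1F is var 0F ⇒ var 0F ∈ X))
   ∧ s at 𝟎 is ↑[ 2 ] a
   ∧ s at k is ↑[ 2 ] b
   ∧ (∀ⁿ (var 0F < ↑ k ⇒
       (∃ⁿ ∃ⁿ ∃ⁿ
         (let j = var 3F; x = var 2F; x′ = var 1F; y = var 0F in
            ↑[ 4 ] s at j is x
          ∧ ↑[ 4 ] s at j + 𝟏 is x′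
          ∧ y ∈ V ⟦ x ⟧
          ∧ y ∈ V ⟦ x′ ⟧)))))

Connected : (X I S : Fin m) → (a b : Term n) → Formula n m
Connected X I S a b =
  ∀ˢ (IsCover (suc X) (suc I) (suc S) 0F ⇒ HasChain (suc X) 0F a b)

{-# OPTIONS --safe #-}

-- A strong V-space has a cover: 0 is an index of every x, so V_x can be taken to
-- be the 0-th vicinity of x.  In the induced V-space every cover satisfies
-- V_x = { y : π(x) = π(y) }, so π(x) = π(y) = π(x′) whenever y is in both V_x and
-- V_x′, and by induction π is constant along any chain.
--
-- To derive this in RCA₀, the arithmetic needed is the injectivity of the pairing
-- function (i, j) ↦ (i + j)² + i, obtained from the semiring laws: terms modulo
-- provable equality form a commutative semiring, to which the ring solver applies.

module Submission where

open import Algebra.Bundles using (CommutativeSemiring)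
import Algebra.Solver.Ring.NaturalCoefficients.Default as SemiringSolver
open import Data.Fin.Base using (Fin; zero; suc)
open import Data.Fin.Patterns using (0F; 1F; 2F; 3F; 4F; 5F; 6F; 7F; 8F)
open import Data.List.Base using (List; []; _∷_; map)
open import Data.List.Relation.Unary.Any using (here; there)
open import Data.Nat.Base as ℕ using (ℕ)
open import Data.Product.Base using (_,_)
open import Data.Vec.Base using (Vec; []; _∷_)
open import Defs
open import Function.Base using (id; _∘_)
open import Level using (0ℓ)
import Relation.Binary.PropositionalEquality as ≡
open ≡ using (_≡_; _≗_; cong; cong₂)

private variable
  n n′ n″ k m m′ m″ : ℕ

infix 2 _⊩_

_⊩_ : List (Formula n m) → Formula n m → Set
Γ ⊩ φ = Derivation RCA₀ Γ φ

private variable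
  Γ : List (Formula n m)
  φ ψ χ : Formula n m
  t t′ u u′ v w x y : Term n
  A X Y I S V π : Fin m

-- Substitution

subT-cong : {σ τ : Fin n → Term n′} → σ ≗ τ → subT σ ≗ subT τ
subT-cong e (var i) = e i
subT-cong e 𝟎       = ≡.refl
subT-cong e 𝟏       = ≡.refl
subT-cong e (t + u) = cong₂ _+_ (subT-cong e t) (subT-cong e u)
subT-cong e (t * u) = cong₂ _*_ (subT-cong e t) (subT-cong e u)

subT-∘ : (σ : Fin n′ → Term n″) (τ : Fin n → Term n′) →
         subT σ ∘ subT τ ≗ subT (subT σ ∘ τ)
subT-∘ σ τ (var i) = ≡.refl
subT-∘ σ τ 𝟎       = ≡.refl
subT-∘ σ τ 𝟏       = ≡.refl
subT-∘ σ τ (t + u) = cong₂ _+_ (subT-∘ σ τ t) (subT-∘ σ τ u)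
subT-∘ σ τ (t * u) = cong₂ _*_ (subT-∘ σ τ t) (subT-∘ σ τ u)

subT-id : {σ : Fin n → Term n} → σ ≗ var → subT σ ≗ id
subT-id e (var i) = e i
subT-id e 𝟎       = ≡.refl
subT-id e 𝟏       = ≡.refl
subT-id e (t + u) = cong₂ _+_ (subT-id e t) (subT-id e u)
subT-id e (t * u) = cong₂ _*_ (subT-id e t) (subT-id e u)

instⁿ-↑ : (u t : Term n) → subT (instⁿ u) (↑ t) ≡ t
instⁿ-↑ u t = ≡.trans (subT-∘ _ _ t) (subT-id (λ _ → ≡.refl) t)

liftⁿ-cong : {σ τ : Fin n → Term n′} → σ ≗ τ → liftⁿ σ ≗ liftⁿ τ
liftⁿ-cong e zero    = ≡.refl
liftⁿ-cong e (suc i) = cong ↑_ (e i)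

liftⁿ-∘ : (σ : Fin n′ → Term n″) (τ : Fin n → Term n′) →
          subT (liftⁿ σ) ∘ liftⁿ τ ≗ liftⁿ (subT σ ∘ τ)
liftⁿ-∘ σ τ zero    = ≡.refl
liftⁿ-∘ σ τ (suc i) =
  ≡.trans (subT-∘ (liftⁿ σ) (var ∘ suc) (τ i)) (≡.sym (subT-∘ (var ∘ suc) σ (τ i)))

liftⁿ-id : {σ : Fin n → Term n} → σ ≗ var → liftⁿ σ ≗ var
liftⁿ-id e zero    = ≡.refl
liftⁿ-id e (suc i) = cong ↑_ (e i)

liftˢ-cong : {ρ θ : Fin m → Fin m′} → ρ ≗ θ → liftˢ ρ ≗ liftˢ θ
liftˢ-cong e zero    = ≡.refl
liftˢ-cong e (suc i) = cong suc (e i)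

liftˢ-∘ : (ρ : Fin m′ → Fin m″) (θ : Fin m → Fin m′) →
          liftˢ ρ ∘ liftˢ θ ≗ liftˢ (ρ ∘ θ)
liftˢ-∘ ρ θ zero    = ≡.refl
liftˢ-∘ ρ θ (suc i) = ≡.refl

liftˢ-id : {ρ : Fin m → Fin m} → ρ ≗ id → liftˢ ρ ≗ id
liftˢ-id e zero    = ≡.refl
liftˢ-id e (suc i) = cong suc (e i)

sub-cong : {σ τ : Fin n → Term n′} {ρ θ : Fin m → Fin m′} →
           σ ≗ τ → ρ ≗ θ → sub σ ρ ≗ sub τ θ
sub-cong e f (t ≈ u) = cong₂ _≈_ (subT-cong e t) (subT-cong e u)
sub-cong e f (t < u) = cong₂ _<_ (subT-cong e t) (subT-cong e u)
sub-cong e f (t ∈ X) = cong₂ _∈_ (subT-cong e t) (f X)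
sub-cong e f ⊥       = ≡.refl
sub-cong e f (φ ∧ ψ) = cong₂ _∧_ (sub-cong e f φ) (sub-cong e f ψ)
sub-cong e f (φ ∨ ψ) = cong₂ _∨_ (sub-cong e f φ) (sub-cong e f ψ)
sub-cong e f (φ ⇒ ψ) = cong₂ _⇒_ (sub-cong e f φ) (sub-cong e f ψ)
sub-cong e f (∀ⁿ φ)  = cong ∀ⁿ_ (sub-cong (liftⁿ-cong e) f φ)
sub-cong e f (∃ⁿ φ)  = cong ∃ⁿ_ (sub-cong (liftⁿ-cong e) f φ)
sub-cong e f (∀ˢ φ)  = cong ∀ˢ_ (sub-cong e (liftˢ-cong f) φ)
sub-cong e f (∃ˢ φ)  = cong ∃ˢ_ (sub-cong e (liftˢ-cong f) φ)

sub-∘ : (σ : Fin n′ → Term n″) (ρ : Fin m′ → Fin m″)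
        (τ : Fin n → Term n′) (θ : Fin m → Fin m′) →
        sub σ ρ ∘ sub τ θ ≗ sub (subT σ ∘ τ) (ρ ∘ θ)
sub-∘ σ ρ τ θ (t ≈ u) = cong₂ _≈_ (subT-∘ σ τ t) (subT-∘ σ τ u)
sub-∘ σ ρ τ θ (t < u) = cong₂ _<_ (subT-∘ σ τ t) (subT-∘ σ τ u)
sub-∘ σ ρ τ θ (t ∈ X) = cong (_∈ ρ (θ X)) (subT-∘ σ τ t)
sub-∘ σ ρ τ θ ⊥       = ≡.refl
sub-∘ σ ρ τ θ (φ ∧ ψ) = cong₂ _∧_ (sub-∘ σ ρ τ θ φ) (sub-∘ σ ρ τ θ ψ)
sub-∘ σ ρ τ θ (φ ∨ ψ) = cong₂ _∨_ (sub-∘ σ ρ τ θ φ) (sub-∘ σ ρ τ θ ψ)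
sub-∘ σ ρ τ θ (φ ⇒ ψ) = cong₂ _⇒_ (sub-∘ σ ρ τ θ φ) (sub-∘ σ ρ τ θ ψ)
sub-∘ σ ρ τ θ (∀ⁿ φ)  = cong ∀ⁿ_ (≡.trans (sub-∘ (liftⁿ σ) ρ (liftⁿ τ) θ φ)
                                          (sub-cong (liftⁿ-∘ σ τ) (λ _ → ≡.refl) φ))
sub-∘ σ ρ τ θ (∃ⁿ φ)  = cong ∃ⁿ_ (≡.trans (sub-∘ (liftⁿ σ) ρ (liftⁿ τ) θ φ)
                                          (sub-cong (liftⁿ-∘ σ τ) (λ _ → ≡.refl) φ))
sub-∘ σ ρ τ θ (∀ˢ φ)  = cong ∀ˢ_ (≡.trans (sub-∘ σ (liftˢ ρ) τ (liftˢ θ) φ)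
                                          (sub-cong (λ _ → ≡.refl) (liftˢ-∘ ρ θ) φ))
sub-∘ σ ρ τ θ (∃ˢ φ)  = cong ∃ˢ_ (≡.trans (sub-∘ σ (liftˢ ρ) τ (liftˢ θ) φ)
                                          (sub-cong (λ _ → ≡.refl) (liftˢ-∘ ρ θ) φ))

sub-id : {σ : Fin n → Term n} {ρ : Fin m → Fin m} → σ ≗ var → ρ ≗ id → sub σ ρ ≗ id
sub-id e f (t ≈ u) = cong₂ _≈_ (subT-id e t) (subT-id e u)
sub-id e f (t < u) = cong₂ _<_ (subT-id e t) (subT-id e u)
sub-id e f (t ∈ X) = cong₂ _∈_ (subT-id e t) (f X)
sub-id e f ⊥       = ≡.refl
sub-id e f (φ ∧ ψ) = cong₂ _∧_ (sub-id e f φ) (sub-id e f ψ)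
sub-id e f (φ ∨ ψ) = cong₂ _∨_ (sub-id e f φ) (sub-id e f ψ)
sub-id e f (φ ⇒ ψ) = cong₂ _⇒_ (sub-id e f φ) (sub-id e f ψ)
sub-id e f (∀ⁿ φ)  = cong ∀ⁿ_ (sub-id (liftⁿ-id e) f φ)
sub-id e f (∃ⁿ φ)  = cong ∃ⁿ_ (sub-id (liftⁿ-id e) f φ)
sub-id e f (∀ˢ φ)  = cong ∀ˢ_ (sub-id e (liftˢ-id f) φ)
sub-id e f (∃ˢ φ)  = cong ∃ˢ_ (sub-id e (liftˢ-id f) φ)

sub-∘-cong : {σ : Fin n′ → Term n″} {ρ : Fin m′ → Fin m″}
             {τ : Fin n → Term n′} {θ : Fin m → Fin m′}
             {σ′ : Fin n → Term n″} {ρ′ : Fin m → Fin m″} →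
             subT σ ∘ τ ≗ σ′ → ρ ∘ θ ≗ ρ′ → sub σ ρ ∘ sub τ θ ≗ sub σ′ ρ′
sub-∘-cong e f φ = ≡.trans (sub-∘ _ _ _ _ φ) (sub-cong e f φ)

instⁿ-wkⁿ : (t : Term n) (φ : Formula n m) → wkⁿ φ [ t ]ⁿ ≡ φ
instⁿ-wkⁿ t φ =
  ≡.trans (sub-∘ _ _ _ _ φ) (sub-id (λ _ → ≡.refl) (λ _ → ≡.refl) φ)

-- Derived rules

⊩-resp-≡ : φ ≡ ψ → Γ ⊩ φ → Γ ⊩ ψ
⊩-resp-≡ ≡.refl d = d

infixl 3 _·_

_·_ : Γ ⊩ φ ⇒ ψ → Γ ⊩ φ → Γ ⊩ ψ
_·_ = ⇒E

cut : Γ ⊩ φ → φ ∷ Γ ⊩ ψ → Γ ⊩ ψ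
cut d e = ⇒I e · d

private variable
  φ₀ φ₁ φ₂ φ₃ φ₄ φ₅ φ₆ φ₇ φ₈ φ₉ : Formula n m

h0 : φ₀ ∷ Γ ⊩ φ₀
h0 = hyp (here ≡.refl)

h1 : φ₀ ∷ φ₁ ∷ Γ ⊩ φ₁
h1 = hyp (there (here ≡.refl))

h2 : φ₀ ∷ φ₁ ∷ φ₂ ∷ Γ ⊩ φ₂
h2 = hyp (there (there (here ≡.refl)))

h3 : φ₀ ∷ φ₁ ∷ φ₂ ∷ φ₃ ∷ Γ ⊩ φ₃
h3 = hyp (there (there (there (here ≡.refl))))

h4 : φ₀ ∷ φ₁ ∷ φ₂ ∷ φ₃ ∷ φ₄ ∷ Γ ⊩ φ₄
h4 = hyp (there (there (there (there (here ≡.refl)))))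

h5 : φ₀ ∷ φ₁ ∷ φ₂ ∷ φ₃ ∷ φ₄ ∷ φ₅ ∷ Γ ⊩ φ₅
h5 = hyp (there (there (there (there (there (here ≡.refl))))))

h6 : φ₀ ∷ φ₁ ∷ φ₂ ∷ φ₃ ∷ φ₄ ∷ φ₅ ∷ φ₆ ∷ Γ ⊩ φ₆
h6 = hyp (there (there (there (there (there (there (here ≡.refl)))))))

h7 : φ₀ ∷ φ₁ ∷ φ₂ ∷ φ₃ ∷ φ₄ ∷ φ₅ ∷ φ₆ ∷ φ₇ ∷ Γ ⊩ φ₇
h7 = hyp (there (there (there (there (there (there (there (here ≡.refl))))))))

h8 : φ₀ ∷ φ₁ ∷ φ₂ ∷ φ₃ ∷ φ₄ ∷ φ₅ ∷ φ₆ ∷ φ₇ ∷ φ₈ ∷ Γ ⊩ φ₈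
h8 = hyp (there (there (there (there (there (there (there (there (here ≡.refl)))))))))

h9 : φ₀ ∷ φ₁ ∷ φ₂ ∷ φ₃ ∷ φ₄ ∷ φ₅ ∷ φ₆ ∷ φ₇ ∷ φ₈ ∷ φ₉ ∷ Γ ⊩ φ₉
h9 = hyp (there (there (there (there (there (there (there (there (there (here ≡.refl))))))))))

excluded-middle : Γ ⊩ φ ∨ ¬ φ
excluded-middle = raa (h0 · ∨I₂ (⇒I (h1 · ∨I₁ h0)))

⊥E : Γ ⊩ ⊥ → Γ ⊩ φ
⊥E d = cut d (raa h1)

∀ⁿ^ : ∀ k → Formula (k ℕ.+ n) m → Formula n m
∀ⁿ^ ℕ.zero    φ = φ
∀ⁿ^ (ℕ.suc k) φ = ∀ⁿ^ k (∀ⁿ φ)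

env : Vec (Term n) k → Fin (k ℕ.+ n) → Term n
env []       i       = var i
env (t ∷ ts) zero    = t
env (t ∷ ts) (suc i) = env ts i

-- The terms are listed in the order of the de Bruijn indices, so that the
-- one for the innermost quantifier comes first.
∀ⁿE* : (ts : Vec (Term n) k) → Γ ⊩ ∀ⁿ^ k φ → Γ ⊩ sub (env ts) id φ
∀ⁿE* {φ = φ} [] d = ⊩-resp-≡ (≡.sym (sub-id (λ _ → ≡.refl) (λ _ → ≡.refl) φ)) d
∀ⁿE* {φ = φ} (t ∷ ts) d =
  ⊩-resp-≡ (sub-∘-cong inst-lift (λ _ → ≡.refl) φ) (∀ⁿE (∀ⁿE* ts d) t)
  where
  inst-lift : subT (instⁿ t) ∘ liftⁿ (env ts) ≗ env (t ∷ ts)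
  inst-lift zero    = ≡.refl
  inst-lift (suc i) = instⁿ-↑ t (env ts i)

∃ⁿI-wkⁿ : Γ ⊩ φ → Γ ⊩ ∃ⁿ wkⁿ φ
∃ⁿI-wkⁿ {φ = φ} d = ∃ⁿI 𝟎 (⊩-resp-≡ (≡.sym (instⁿ-wkⁿ 𝟎 φ)) d)

∀ⁿE-var₀ : Γ ⊩ wkⁿ (∀ⁿ φ) → Γ ⊩ φ
∀ⁿE-var₀ {φ = φ} d = ⊩-resp-≡
  (≡.trans (sub-∘ _ _ _ _ φ) (sub-id (λ { zero → ≡.refl ; (suc _) → ≡.refl }) (λ _ → ≡.refl) φ))
  (∀ⁿE d (var 0F))

∀ⁿE-suc : Γ ⊩ wkⁿ (∀ⁿ φ) → Γ ⊩ φ [x+1]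
∀ⁿE-suc {φ = φ} d = ⊩-resp-≡
  (sub-∘-cong (λ { zero → ≡.refl ; (suc _) → ≡.refl }) (λ _ → ≡.refl) φ)
  (∀ⁿE d (var 0F + 𝟏))

-- Induction and comprehension up to provable equivalence

induction : Σ₁ φ → Γ ⊩ ∀ⁿ (ψ ⇔ φ) → Γ ⊩ ψ [ 𝟎 ]ⁿ → ψ ∷ map wkⁿ Γ ⊩ ψ [x+1] → Γ ⊩ ∀ⁿ ψ
induction {φ = φ} {ψ = ψ} σ e base step =
  -- The three premises become hypotheses, so that `∀ⁿI` weakens them as formulas and no derivation
  -- has to be weakened.
  ⇒I (⇒I (⇒I (cut
    -- The axiom is applied to `φ`, which has the literal `Σ₁` shape. The equivalence carries base
    -- and step from `ψ` to `φ`, and the conclusion back.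
    (axiom (Σ₁-induction σ) · ∧I
      (∧E₁ (∀ⁿE h2 𝟎) · h1)
      (∀ⁿI (⇒I (∧E₁ (∀ⁿE-suc {φ = ψ ⇔ φ} h3) ·
        (∀ⁿE-var₀ {φ = ψ ⇒ ψ [x+1]} h1 · (∧E₂ (∀ⁿE-var₀ {φ = ψ ⇔ φ} h3) · h0))))))
    (∀ⁿI (∧E₂ (∀ⁿE-var₀ {φ = ψ ⇔ φ} h3) · ∀ⁿE-var₀ {φ = φ} h0)))))
  · e · base · ∀ⁿI (⇒I step)

∃ⁿ-wkⁿ-⇔ : Γ ⊩ φ ⇔ (∃ⁿ wkⁿ φ)
∃ⁿ-wkⁿ-⇔ = ∧I (⇒I (∃ⁿI-wkⁿ h0)) (⇒I (∃ⁿE h0 h0))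

∀ⁿ-wkⁿ-⇔ : Γ ⊩ φ ⇔ (∀ⁿ wkⁿ φ)
∀ⁿ-wkⁿ-⇔ {φ = φ} = ∧I (⇒I (∀ⁿI h0)) (⇒I (⊩-resp-≡ (instⁿ-wkⁿ 𝟎 φ) (∀ⁿE {φ = wkⁿ φ} h0 𝟎)))

-- A Δ₀ formula is Σ₁ and Π₁ by means of a vacuous quantifier.
Δ₀-induction : Δ₀ (wkⁿ φ) → Γ ⊩ φ [ 𝟎 ]ⁿ → φ ∷ map wkⁿ Γ ⊩ φ [x+1] → Γ ⊩ ∀ⁿ φ
Δ₀-induction δ = induction (∃Δ₀ δ) (∀ⁿI ∃ⁿ-wkⁿ-⇔)

⇔-refl : Γ ⊩ φ ⇔ φ
⇔-refl = ∧I (⇒I h0) (⇒I h0)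

⇔-trans : Γ ⊩ φ ⇔ ψ → Γ ⊩ ψ ⇔ χ → Γ ⊩ φ ⇔ χ
⇔-trans d e = ⇒I (⇒I (∧I (⇒I (∧E₁ h1 · (∧E₁ h2 · h0))) (⇒I (∧E₂ h2 · (∧E₂ h1 · h0))))) · d · e

⇔-sym : Γ ⊩ φ ⇔ ψ → Γ ⊩ ψ ⇔ φ
⇔-sym d = ∧I (∧E₂ d) (∧E₁ d)

Δ₀-comprehension : Δ₀ (wkⁿ φ) → Γ ⊩ ∃ˢ ∀ⁿ (var 0F ∈ 0F ⇔ wkˢ φ)
Δ₀-comprehension {φ = φ} δ = ∃ˢE
  (axiom (Δ₁-comprehension (∃Δ₀ δ) (∀Δ₀ δ)) · ∀ⁿI (⇔-trans (⇔-sym ∃ⁿ-wkⁿ-⇔) ∀ⁿ-wkⁿ-⇔))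
  (∃ˢI 0F (⊩-resp-≡ (cong (λ χ → ∀ⁿ (var 0F ∈ 0F ⇔ χ)) wkˢ-inst)
    (∀ⁿI (⇔-trans (∀ⁿE-var₀ h0)
      (⊩-resp-≡ (cong (λ χ → (∃ⁿ χ) ⇔ wkˢ φ) wkⁿ-wkˢ) (⇔-sym ∃ⁿ-wkⁿ-⇔))))))
  where
  wkⁿ-wkˢ : wkⁿ (wkˢ φ) ≡ sub (liftⁿ var) suc (wkⁿ φ)
  wkⁿ-wkˢ = ≡.trans (sub-∘ _ _ _ _ φ) (≡.sym (sub-∘ _ _ _ _ φ))

  wkˢ-inst : wkˢ φ ≡ sub (liftⁿ var) (instˢ 0F) (sub (liftⁿ var) (liftˢ suc) (wkˢ φ))
  wkˢ-inst = ≡.sym (≡.trans (sub-∘ _ _ _ _ (wkˢ φ)) (sub-∘-cong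
    (λ { zero → ≡.refl ; (suc _) → ≡.refl }) (λ _ → ≡.refl) φ))

-- Arithmetic

≈-sym : Γ ⊩ t ≈ u → Γ ⊩ u ≈ t
≈-sym {t = t} {u = u} d = ⊩-resp-≡ (cong (u ≈_) (instⁿ-↑ u t))
  (≈-subst (var 0F ≈ ↑ t) d (⊩-resp-≡ (cong (t ≈_) (≡.sym (instⁿ-↑ t t))) ≈-refl))

≈-trans : Γ ⊩ t ≈ u → Γ ⊩ u ≈ v → Γ ⊩ t ≈ v
≈-trans {t = t} {u = u} {v = v} d e = ⊩-resp-≡ (cong (_≈ v) (instⁿ-↑ v t))
  (≈-subst (↑ t ≈ var 0F) e (⊩-resp-≡ (cong (_≈ u) (≡.sym (instⁿ-↑ u t))) d))

-- Leibniz's rule is applied to a reflexivity whose left side is protected by `↑`, so only the right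
-- side is rewritten.
subT-≈ : (c : Term (ℕ.suc n)) → Γ ⊩ t ≈ u → Γ ⊩ subT (instⁿ t) c ≈ subT (instⁿ u) c
subT-≈ {t = t} {u = u} c d = ⊩-resp-≡ (cong (_≈ c[ u ]) (instⁿ-↑ u c[ t ]))
  (≈-subst (↑ c[ t ] ≈ c) d (⊩-resp-≡ (cong (_≈ c[ t ]) (≡.sym (instⁿ-↑ t c[ t ]))) ≈-refl))
  where
  c[_] : Term _ → Term _
  c[ x ] = subT (instⁿ x) c

+-congˡ : ∀ v → Γ ⊩ t ≈ u → Γ ⊩ v + t ≈ v + u
+-congˡ {t = t} {u = u} v d = ⊩-resp-≡ (cong₂ (λ a b → a + t ≈ b + u) (instⁿ-↑ t v) (instⁿ-↑ u v))
  (subT-≈ (↑ v + var 0F) d)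

+-congʳ : ∀ v → Γ ⊩ t ≈ u → Γ ⊩ t + v ≈ u + v
+-congʳ {t = t} {u = u} v d = ⊩-resp-≡ (cong₂ (λ a b → t + a ≈ u + b) (instⁿ-↑ t v) (instⁿ-↑ u v))
  (subT-≈ (var 0F + ↑ v) d)

*-congˡ : ∀ v → Γ ⊩ t ≈ u → Γ ⊩ v * t ≈ v * u
*-congˡ {t = t} {u = u} v d = ⊩-resp-≡ (cong₂ (λ a b → a * t ≈ b * u) (instⁿ-↑ t v) (instⁿ-↑ u v))
  (subT-≈ (↑ v * var 0F) d)

*-congʳ : ∀ v → Γ ⊩ t ≈ u → Γ ⊩ t * v ≈ u * v
*-congʳ {t = t} {u = u} v d = ⊩-resp-≡ (cong₂ (λ a b → t * a ≈ u * b) (instⁿ-↑ t v) (instⁿ-↑ u v))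
  (subT-≈ (var 0F * ↑ v) d)

+-cong : Γ ⊩ t ≈ t′ → Γ ⊩ u ≈ u′ → Γ ⊩ t + u ≈ t′ + u′
+-cong d e = ≈-trans (+-congʳ _ d) (+-congˡ _ e)

*-cong : Γ ⊩ t ≈ t′ → Γ ⊩ u ≈ u′ → Γ ⊩ t * u ≈ t′ * u′
*-cong d e = ≈-trans (*-congʳ _ d) (*-congˡ _ e)

+-identityʳ : Γ ⊩ t + 𝟎 ≈ t
+-identityʳ = ∀ⁿE* (_ ∷ []) (axiom +-zero)

+-sucʳ : Γ ⊩ t + (u + 𝟏) ≈ (t + u) + 𝟏
+-sucʳ = ∀ⁿE* (_ ∷ _ ∷ []) (axiom +-suc)

*-zeroʳ : Γ ⊩ t * 𝟎 ≈ 𝟎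
*-zeroʳ = ∀ⁿE* (_ ∷ []) (axiom *-zero)

*-sucʳ : Γ ⊩ t * (u + 𝟏) ≈ t * u + t
*-sucʳ = ∀ⁿE* (_ ∷ _ ∷ []) (axiom *-suc)

-- The axioms recurse on the right argument, so the laws for the left one need induction.
+-identityˡ : Γ ⊩ 𝟎 + t ≈ t
+-identityˡ {t = t} = ∀ⁿE* (t ∷ []) (Δ₀-induction {φ = 𝟎 + var 0F ≈ var 0F} ≈-Δ₀
  +-identityʳ
  (≈-trans +-sucʳ (+-congʳ 𝟏 h0)))

+-sucˡ : Γ ⊩ (t + 𝟏) + u ≈ (t + u) + 𝟏
+-sucˡ {t = t} {u = u} = ∀ⁿE* (u ∷ t ∷ []) (∀ⁿI (Δ₀-induction
  {φ = (var 1F + 𝟏) + var 0F ≈ (var 1F + var 0F) + 𝟏} ≈-Δ₀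
  (≈-trans +-identityʳ (+-congʳ 𝟏 (≈-sym +-identityʳ)))
  (≈-trans +-sucʳ (+-congʳ 𝟏 (≈-trans h0 (≈-sym +-sucʳ))))))

+-comm : ∀ t u → Γ ⊩ t + u ≈ u + t
+-comm t u = ∀ⁿE* (u ∷ t ∷ []) (∀ⁿI (Δ₀-induction
  {φ = var 1F + var 0F ≈ var 0F + var 1F} ≈-Δ₀
  (≈-trans +-identityʳ (≈-sym +-identityˡ))
  (≈-trans +-sucʳ (≈-trans (+-congʳ 𝟏 h0) (≈-sym +-sucˡ)))))

+-assoc : ∀ t u v → Γ ⊩ (t + u) + v ≈ t + (u + v)
+-assoc t u v = ∀ⁿE* (v ∷ u ∷ t ∷ []) (∀ⁿI (∀ⁿI (Δ₀-induction
  {φ = (var 2F + var 1F) + var 0F ≈ var 2F + (var 1F + var 0F)} ≈-Δ₀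
  (≈-trans +-identityʳ (+-congˡ _ (≈-sym +-identityʳ)))
  (≈-trans +-sucʳ (≈-trans (+-congʳ 𝟏 h0) (≈-trans (≈-sym +-sucʳ) (+-congˡ _ (≈-sym +-sucʳ))))))))

*-zeroˡ : Γ ⊩ 𝟎 * t ≈ 𝟎
*-zeroˡ {t = t} = ∀ⁿE* (t ∷ []) (Δ₀-induction {φ = 𝟎 * var 0F ≈ 𝟎} ≈-Δ₀
  *-zeroʳ
  (≈-trans *-sucʳ (≈-trans +-identityʳ h0)))

*-sucˡ : Γ ⊩ (t + 𝟏) * u ≈ t * u + u
*-sucˡ {t = t} {u = u} = ∀ⁿE* (u ∷ t ∷ []) (∀ⁿI (Δ₀-induction
  {φ = (var 1F + 𝟏) * var 0F ≈ var 1F * var 0F + var 0F} ≈-Δ₀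
  (≈-trans *-zeroʳ (≈-sym (≈-trans +-identityʳ *-zeroʳ)))
  (≈-trans *-sucʳ (≈-trans (+-congʳ _ h0) (≈-trans rearrange (+-congʳ _ (≈-sym *-sucʳ)))))))
  where
  rearrange : Γ ⊩ (v + w) + (x + 𝟏) ≈ (v + x) + (w + 𝟏)
  rearrange {v = v} {w = w} {x = x} = ≈-trans +-sucʳ (≈-trans (+-congʳ 𝟏
    (≈-trans (+-assoc v w x) (≈-trans (+-congˡ v (+-comm w x)) (≈-sym (+-assoc v x w)))))
    (≈-sym +-sucʳ))

*-comm : ∀ t u → Γ ⊩ t * u ≈ u * t
*-comm t u = ∀ⁿE* (u ∷ t ∷ []) (∀ⁿI (Δ₀-induction
  {φ = var 1F * var 0F ≈ var 0F * var 1F} ≈-Δ₀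
  (≈-trans *-zeroʳ (≈-sym *-zeroˡ))
  (≈-trans *-sucʳ (≈-trans (+-congʳ _ h0) (≈-sym *-sucˡ)))))

*-distribˡ-+ : ∀ t u v → Γ ⊩ t * (u + v) ≈ t * u + t * v
*-distribˡ-+ t u v = ∀ⁿE* (v ∷ u ∷ t ∷ []) (∀ⁿI (∀ⁿI (Δ₀-induction
  {φ = var 2F * (var 1F + var 0F) ≈ var 2F * var 1F + var 2F * var 0F} ≈-Δ₀
  (≈-trans (*-congˡ _ +-identityʳ) (≈-sym (≈-trans (+-congˡ _ *-zeroʳ) +-identityʳ)))
  (≈-trans (*-congˡ _ +-sucʳ) (≈-trans *-sucʳ (≈-trans (+-congʳ _ h0)
    (≈-trans (+-assoc _ _ _) (+-congˡ _ (≈-sym *-sucʳ)))))))))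

*-distribʳ-+ : ∀ t u v → Γ ⊩ (u + v) * t ≈ u * t + v * t
*-distribʳ-+ t u v = ≈-trans (*-comm _ _)
  (≈-trans (*-distribˡ-+ t u v) (+-cong (*-comm _ _) (*-comm _ _)))

*-assoc : ∀ t u v → Γ ⊩ (t * u) * v ≈ t * (u * v)
*-assoc t u v = ∀ⁿE* (v ∷ u ∷ t ∷ []) (∀ⁿI (∀ⁿI (Δ₀-induction
  {φ = (var 2F * var 1F) * var 0F ≈ var 2F * (var 1F * var 0F)} ≈-Δ₀
  (≈-trans *-zeroʳ (≈-sym (≈-trans (*-congˡ _ *-zeroʳ) *-zeroʳ)))
  (≈-trans *-sucʳ (≈-trans (+-congʳ _ h0) (≈-trans (≈-sym (*-distribˡ-+ _ _ _)) (*-congˡ _ (≈-sym *-sucʳ))))))))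

*-identityʳ : ∀ t → Γ ⊩ t * 𝟏 ≈ t
*-identityʳ t = ≈-trans (*-congˡ t (≈-sym +-identityˡ))
  (≈-trans *-sucʳ (≈-trans (+-congʳ t *-zeroʳ) +-identityˡ))

terms : List (Formula n m) → CommutativeSemiring 0ℓ 0ℓ
terms {n} Γ = record
  { Carrier = Term n
  ; _≈_ = λ t u → Γ ⊩ t ≈ u
  ; _+_ = _+_ ; _*_ = _*_ ; 0# = 𝟎 ; 1# = 𝟏
  ; isCommutativeSemiring = record
    { isSemiring = record
      { isSemiringWithoutAnnihilatingZero = record
        { +-isCommutativeMonoid = record
          { isMonoid = record
            { isSemigroup = record
              { isMagma = record
                { isEquivalence = record { refl = ≈-refl ; sym = ≈-sym ; trans = ≈-trans }
                ; ∙-cong = +-cong }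
              ; assoc = +-assoc }
            ; identity = (λ _ → +-identityˡ) , (λ _ → +-identityʳ) }
          ; comm = +-comm }
        ; *-cong = *-cong
        ; *-assoc = *-assoc
        ; *-identity = (λ t → ≈-trans (*-comm 𝟏 t) (*-identityʳ t)) , *-identityʳ
        ; distrib = *-distribˡ-+ , *-distribʳ-+ }
      ; zero = (λ _ → *-zeroˡ) , (λ _ → *-zeroʳ) }
    ; *-comm = *-comm }
  }

module Solver {n m} {Γ : List (Formula n m)} = SemiringSolver (terms Γ)
open Solver using (solve; _:+_; _:*_; _:=_; con)

-- Cancellation and injectivity of the pairing function

suc-injective : Γ ⊩ t + 𝟏 ≈ u + 𝟏 → Γ ⊩ t ≈ u
suc-injective d = ∀ⁿE* (_ ∷ _ ∷ []) (axiom suc-inj) · d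

+-cancelʳ : ∀ v → Γ ⊩ t + v ≈ u + v → Γ ⊩ t ≈ u
+-cancelʳ {t = t} {u = u} v d = ∀ⁿE* (v ∷ u ∷ t ∷ []) (∀ⁿI (∀ⁿI (Δ₀-induction
  {φ = var 2F + var 0F ≈ var 1F + var 0F ⇒ var 2F ≈ var 1F} (⇒-Δ₀ ≈-Δ₀ ≈-Δ₀)
  (⇒I (≈-trans (≈-sym +-identityʳ) (≈-trans h0 +-identityʳ)))
  (⇒I (h1 · suc-injective (≈-trans (≈-sym +-sucʳ) (≈-trans h0 +-sucʳ))))))) · d

+-cancelˡ : ∀ v → Γ ⊩ v + t ≈ v + u → Γ ⊩ t ≈ u
+-cancelˡ v d = +-cancelʳ v (≈-trans (+-comm _ v) (≈-trans d (+-comm v _)))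

t≉t+suc : Γ ⊩ t ≈ t + (u + 𝟏) → Γ ⊩ ⊥
t≉t+suc {t = t} d = ∀ⁿE* (_ ∷ []) (axiom suc≉0) ·
  ≈-sym (+-cancelˡ t (≈-trans +-identityʳ d))

-- The disjunction stays under the quantifier so that the formula is `Σ₁` as it stands; in the zero
-- case the witness is arbitrary.
zero-or-suc : ∀ t → Γ ⊩ ∃ⁿ (↑ t ≈ 𝟎 ∨ ↑ t ≈ var 0F + 𝟏)
zero-or-suc t = ∀ⁿE* (t ∷ []) (induction
  {ψ = ∃ⁿ (var 1F ≈ 𝟎 ∨ var 1F ≈ var 0F + 𝟏)} (∃Δ₀ (∨-Δ₀ ≈-Δ₀ ≈-Δ₀)) (∀ⁿI ⇔-refl)
  (∃ⁿI 𝟎 (∨I₁ ≈-refl))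
  (∃ⁿI (var 0F) (∨I₂ ≈-refl)))

-- Comparison by an explicit difference rather than by `<`, so that the result can be fed into
-- semiring identities.
+-total : ∀ t u → Γ ⊩ ∃ⁿ (↑ t ≈ ↑ u + var 0F ∨ ↑ u ≈ ↑ t + var 0F)
+-total t u = ∀ⁿE* (t ∷ u ∷ []) (∀ⁿI (induction
  {ψ = ∃ⁿ (var 1F ≈ var 2F + var 0F ∨ var 2F ≈ var 1F + var 0F)}
  (∃Δ₀ (∨-Δ₀ ≈-Δ₀ ≈-Δ₀)) (∀ⁿI ⇔-refl)
  (∃ⁿI (var 0F) (∨I₂ (≈-sym +-identityˡ)))
  (∃ⁿE h0 (∨E h0
    (∃ⁿI (var 0F + 𝟏) (∨I₁ (≈-trans (+-congʳ 𝟏 h0) (≈-sym +-sucʳ))))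
    -- Here `u` is `x + d` for the induction variable `x`. If `d` is zero, `x + 𝟏` overtakes `u` by
    -- one; if `d` is `e + 𝟏`, the new difference is `e`.
    (∃ⁿE (zero-or-suc (var 0F)) (∨E h0
      (∃ⁿI 𝟏 (∨I₁ (+-congʳ 𝟏 (≈-sym (≈-trans h2 (≈-trans (+-congˡ _ h0) +-identityʳ))))))
      (∃ⁿI (var 0F) (∨I₂ (≈-trans h2 (≈-trans (+-congˡ _ h0) (≈-trans +-sucʳ (≈-sym +-sucˡ))))))))))))

-- If i′ + j′ = i + j + e + 1 then ⟨ i′ , j′ ⟩ exceeds ⟨ i , j ⟩.
⟨⟩-gap : ∀ i j e i′ → Γ ⊩
  ((i + j) + (e + 𝟏)) * ((i + j) + (e + 𝟏)) + i′ ≈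
  ⟨ i , j ⟩ + ((((i + j) + e) * (e + 𝟏) + (((i + j) * e + j) + (e + i′))) + 𝟏)
⟨⟩-gap = solve 4 (λ i j e i′ →
  ((i :+ j) :+ (e :+ con 1)) :* ((i :+ j) :+ (e :+ con 1)) :+ i′ :=
  ((i :+ j) :* (i :+ j) :+ i) :+
  ((((i :+ j) :+ e) :* (e :+ con 1) :+ (((i :+ j) :* e :+ j) :+ (e :+ i′))) :+ con 1)) ≈-refl

-- If `d` were a successor, `⟨⟩-gap` would make `⟨ i , j ⟩` equal to itself plus a successor; hence
-- `d` is zero.
⟨⟩-sum-≤ : ∀ i j i′ j′ d →
  Γ ⊩ ⟨ i , j ⟩ ≈ ⟨ i′ , j′ ⟩ ⇒ i′ + j′ ≈ (i + j) + d ⇒ i + j ≈ i′ + j′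
⟨⟩-sum-≤ i j i′ j′ d = ⇒I (⇒I (∃ⁿE (zero-or-suc d) (∨E h0
  (≈-sym (≈-trans h2 (≈-trans (+-congˡ _ h0) +-identityʳ)))
  (cut (≈-trans h2 (+-congˡ _ h0)) (⊥E (t≉t+suc
    (≈-trans h4 (≈-trans (+-congʳ _ (*-cong h0 h0)) (⟨⟩-gap (↑ i) (↑ j) (var 0F) (↑ i′))))))))))

⟨⟩-injective-+ : Γ ⊩ ⟨ t , u ⟩ ≈ ⟨ t′ , u′ ⟩ → Γ ⊩ t + u ≈ t′ + u′
⟨⟩-injective-+ {t = t} {u = u} {t′ = t′} {u′ = u′} d = cut d
  (∃ⁿE (+-total (t′ + u′) (t + u)) (∨E h0
    (⟨⟩-sum-≤ _ _ _ _ _ · h2 · h0)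
    (≈-sym (⟨⟩-sum-≤ _ _ _ _ _ · ≈-sym h2 · h0))))

-- Equal sums have equal squares, which cancel and leave the first components.
⟨⟩-injective₁ : Γ ⊩ ⟨ t , u ⟩ ≈ ⟨ t′ , u′ ⟩ → Γ ⊩ t ≈ t′
⟨⟩-injective₁ d = +-cancelˡ _ (≈-trans d (≈-sym (+-congʳ _ (*-cong e e))))
  where e = ⟨⟩-injective-+ d

⟨⟩-injective₂ : Γ ⊩ ⟨ t , u ⟩ ≈ ⟨ t′ , u′ ⟩ → Γ ⊩ u ≈ u′
⟨⟩-injective₂ d = +-cancelˡ _ (≈-trans (⟨⟩-injective-+ d) (+-congʳ _ (≈-sym (⟨⟩-injective₁ d))))

⟨⟩-cong : Γ ⊩ t ≈ t′ → Γ ⊩ u ≈ u′ → Γ ⊩ ⟨ t , u ⟩ ≈ ⟨ t′ , u′ ⟩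
⟨⟩-cong d e = +-cong (*-cong (+-cong d e) (+-cong d e)) d

-- Order

<-suc⇔ : ∀ t u → Γ ⊩ t < u + 𝟏 ⇔ t < u ∨ t ≈ u
<-suc⇔ t u = ∀ⁿE* (u ∷ t ∷ []) (axiom <-suc)

<-respʳ-≈ : Γ ⊩ u ≈ u′ → Γ ⊩ t < u → Γ ⊩ t < u′
<-respʳ-≈ {u = u} {u′ = u′} {t = t} d e = ⊩-resp-≡ (cong (_< u′) (instⁿ-↑ u′ t))
  (≈-subst (↑ t < var 0F) d (⊩-resp-≡ (cong (_< u) (≡.sym (instⁿ-↑ u t))) e))

<-respˡ-≈ : Γ ⊩ t ≈ t′ → Γ ⊩ t < u → Γ ⊩ t′ < u
<-respˡ-≈ {t = t} {t′ = t′} {u = u} d e = ⊩-resp-≡ (cong (t′ <_) (instⁿ-↑ t′ u))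
  (≈-subst (var 0F < ↑ u) d (⊩-resp-≡ (cong (t <_) (≡.sym (instⁿ-↑ t u))) e))

∈-resp-≈ : Γ ⊩ t ≈ t′ → Γ ⊩ t ∈ A → Γ ⊩ t′ ∈ A
∈-resp-≈ {A = A} = ≈-subst (var 0F ∈ A)

t<t+1 : Γ ⊩ t < t + 𝟏
t<t+1 = ∧E₂ (<-suc⇔ _ _) · ∨I₂ ≈-refl

<⇒<suc : Γ ⊩ t < u → Γ ⊩ t < u + 𝟏
<⇒<suc d = ∧E₂ (<-suc⇔ _ _) · ∨I₁ d

-- The order axioms treat only zero and successors on the right of `<`. This turns additive
-- decompositions into inequalities, and is the source of the bounds on pairs and witnesses.
t<t+u+1 : ∀ t u → Γ ⊩ t < (t + u) + 𝟏
t<t+u+1 t u = ∀ⁿE* (u ∷ t ∷ []) (∀ⁿI (Δ₀-induction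
  {φ = var 1F < (var 1F + var 0F) + 𝟏} <-Δ₀
  (<-respʳ-≈ (+-congʳ 𝟏 (≈-sym +-identityʳ)) t<t+1)
  (<⇒<suc (<-respʳ-≈ (≈-sym +-sucʳ) h0))))

0<t+1 : Γ ⊩ 𝟎 < t + 𝟏
0<t+1 = <-respʳ-≈ (+-congʳ 𝟏 +-identityˡ) (t<t+u+1 𝟎 _)

suc-cancel-< : Γ ⊩ t + 𝟏 < u + 𝟏 → Γ ⊩ t < u
suc-cancel-< {t = t} {u = u} d = ∀ⁿE* (u ∷ t ∷ []) (∀ⁿI (Δ₀-induction
  {φ = var 1F + 𝟏 < var 0F + 𝟏 ⇒ var 1F < var 0F} (⇒-Δ₀ <-Δ₀ <-Δ₀)
  (⇒I (⊥E (∨E (∧E₁ (<-suc⇔ _ _) · h0)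
    (∀ⁿE* (_ ∷ []) (axiom ≮0) · h0)
    (∀ⁿE* (_ ∷ []) (axiom suc≉0) · h0))))
  (⇒I (∨E (∧E₁ (<-suc⇔ _ _) · h0)
    (<⇒<suc (h2 · h0))
    (<-respʳ-≈ h0 t<t+1))))) · d

zero-or-pos : ∀ t → Γ ⊩ t ≈ 𝟎 ∨ 𝟎 < t
zero-or-pos t = ∀ⁿE* (t ∷ []) (Δ₀-induction {φ = var 0F ≈ 𝟎 ∨ 𝟎 < var 0F} (∨-Δ₀ ≈-Δ₀ <-Δ₀)
  (∨I₁ ≈-refl)
  (∨I₂ 0<t+1))

i<⟨i,j⟩+1 : ∀ i j → Γ ⊩ i < ⟨ i , j ⟩ + 𝟏
i<⟨i,j⟩+1 i j = <-respʳ-≈ (+-congʳ 𝟏 (+-comm i _)) (t<t+u+1 i _)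

-- For `j ≈ e + 𝟏` the square inside the pair contains `j` as a summand; `square` displays the
-- remainder.
j<⟨i,j⟩+1 : ∀ i j → Γ ⊩ j < ⟨ i , j ⟩ + 𝟏
j<⟨i,j⟩+1 i j = ∃ⁿE (zero-or-suc j) (∨E h0
  (<-respˡ-≈ (≈-sym h0) 0<t+1)
  (<-respˡ-≈ (≈-sym h0) (<-respʳ-≈
    (+-congʳ 𝟏 (≈-trans (square (↑ i) (var 0F)) (⟨⟩-cong (≈-refl {t = ↑ i}) (≈-sym h0))))
    (t<t+u+1 _ _))))
  where
  square : ∀ i e → Γ ⊩ (e + 𝟏) + ((i + e) * (i + e) + ((i + i) + (e + i))) ≈ ⟨ i , e + 𝟏 ⟩
  square = solve 2 (λ i e →
    (e :+ con 1) :+ ((i :+ e) :* (i :+ e) :+ ((i :+ i) :+ (e :+ i))) :=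
    (i :+ (e :+ con 1)) :* (i :+ (e :+ con 1)) :+ i) ≈-refl

-- Codes of finite sequences

-- Any member exhibits the components of the code. Working with variables first lets the weakenings
-- inside `∈ᶠ` compute.
∈ᶠ-code : ∀ s i → Γ ⊩ i ∈ᶠ s ⇒
  (∃ⁿ ∃ⁿ ∃ⁿ (↑[ 3 ] s ≈ ⟨ var 2F , ⟨ var 1F , var 0F ⟩ ⟩))
∈ᶠ-code s i = ∀ⁿE*
  {φ = var 1F ∈ᶠ var 0F ⇒ (∃ⁿ ∃ⁿ ∃ⁿ (var 3F ≈ ⟨ var 2F , ⟨ var 1F , var 0F ⟩ ⟩))}
  (s ∷ i ∷ [])
  (∀ⁿI (∀ⁿI (⇒I (∃ⁿE h0 (∃ⁿE h0 (∃ⁿE h0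
    (∃ⁿI (var 2F) (∃ⁿI (var 1F) (∃ⁿI (var 0F) (∧E₁ h0))))))))))

-- Pairing is injective, so the components hidden in `i ∈ᶠ s` agree with the given `k`, `p`, `q`;
-- this removes the unbounded quantifiers of `∈ᶠ`.
∈ᶠ-decode : ∀ i s k p q →
  Γ ⊩ s ≈ ⟨ k , ⟨ p , q ⟩ ⟩ ⇒ i ∈ᶠ s ⇒ i < k ∧ (p * (i + 𝟏) + 𝟏) ∣ q
∈ᶠ-decode i s k p q = ∀ⁿE*
  {φ = var 3F ≈ ⟨ var 2F , ⟨ var 1F , var 0F ⟩ ⟩ ⇒ var 4F ∈ᶠ var 3F ⇒
    var 4F < var 2F ∧ (var 1F * (var 4F + 𝟏) + 𝟏) ∣ var 0F}
  (q ∷ p ∷ k ∷ s ∷ i ∷ [])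
  (∀ⁿI (∀ⁿI (∀ⁿI (∀ⁿI (∀ⁿI (⇒I (⇒I (∃ⁿE h0 (∃ⁿE h0 (∃ⁿE h0
    (cut (≈-trans (≈-sym (∧E₁ h0)) h4) (∧I
      (<-respʳ-≈ (⟨⟩-injective₁ h0) (∧E₁ (∧E₂ h1)))
      (∃ⁿE (∧E₂ (∧E₂ h1)) (∃ⁿI (var 0F)
        (≈-trans (≈-sym (⟨⟩-injective₂ (⟨⟩-injective₂ h1)))
          (≈-trans h0 (*-congʳ _ (+-congʳ 𝟏 (*-congʳ _
            (⟨⟩-injective₁ (⟨⟩-injective₂ h1)))))))))))))))))))))

-- The free variables 0F, 1F, 2F, 3F are an index j, a code s of a sequence, a
-- value c, and the last index k of s.
SeqValue : Fin m → Formula (4 ℕ.+ n) m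
SeqValue π = var 0F < var 3F + 𝟏 ⇒
  (∃ⁿ (var 2F at var 1F is var 0F ∧ ⟨ var 0F , var 3F ⟩ ∈ π))

-- SeqValue is not literally Σ₁, as it hides unbounded quantifiers over the
-- components of the code s.  Once these are fixed, the term x of s and the
-- quotient r witnessing divisibility have the common strict bound x + r + 1.
SeqValue-induction : Γ ⊩ ∀ⁿ ∀ⁿ ∀ⁿ (
  (∃ⁿ ∃ⁿ ∃ⁿ (var 3F ≈ ⟨ var 2F , ⟨ var 1F , var 0F ⟩ ⟩)) ⇒
  SeqValue π [ 𝟎 ]ⁿ ⇒
  (∀ⁿ (SeqValue π ⇒ SeqValue π [x+1])) ⇒
  (∀ⁿ SeqValue π))
SeqValue-induction {π = π} = ∀ⁿI (∀ⁿI (∀ⁿI (⇒I (⇒I (⇒I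
  (∃ⁿE h2 (∃ⁿE h0 (∃ⁿE h0 (induction {φ = bounded}
    (∃Δ₀ (⇒-Δ₀ <-Δ₀ (∃-Δ₀ (var 0F) (∃-Δ₀ (var 1F) (∧-Δ₀ <-Δ₀ (∧-Δ₀ ≈-Δ₀ ∈-Δ₀))))))
    (∀ⁿI (∧I (⇒I to) (⇒I from)))
    h4
    (∀ⁿE-var₀ h4 · h0))))))))))
  where
  -- The free variables `0F` to `6F` are the index, the components `q`, `p`, `k` of the code, then
  -- the code, the value and the last index.
  bounded : Formula (7 ℕ.+ n) _
  bounded = ∃ⁿ (var 1F < var 7F + 𝟏 ⇒
    (∃ⁿ (var 0F < var 1F ∧ (∃ⁿ (var 0F < var 2F ∧
      ( ⟨ var 3F , var 1F ⟩ < var 6F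
      ∧ var 4F ≈ (var 5F * (⟨ var 3F , var 1F ⟩ + 𝟏) + 𝟏) * var 0F
      ∧ ⟨ var 1F , var 8F ⟩ ∈ π))))))

  value : Formula (7 ℕ.+ n) _
  value = var 0F < var 6F + 𝟏 ⇒
    (∃ⁿ (var 5F at var 1F is var 0F ∧ ⟨ var 0F , var 6F ⟩ ∈ π))

  code : Formula (7 ℕ.+ n) m
  code = var 4F ≈ ⟨ var 3F , ⟨ var 2F , var 1F ⟩ ⟩

  to : value ∷ code ∷ Γ ⊩ bounded
  -- The bound is quantified in front of the implication, so it must be chosen before the guard is
  -- assumed. If the guard fails, `𝟎` serves as a default.
  to = ∨E excluded-middle
    (∃ⁿE (h1 · h0) (cut
      (∈ᶠ-decode ⟨ var 1F , var 0F ⟩ (var 5F) (var 4F) (var 3F) (var 2F) · h3 · ∧E₁ h0)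
      (∃ⁿE (∧E₂ h0) (∃ⁿI ((var 1F + var 0F) + 𝟏) (⇒I (∃ⁿI (var 1F) (∧I (t<t+u+1 _ _)
        (∃ⁿI (var 0F) (∧I (<-respʳ-≈ (+-congʳ 𝟏 (+-comm _ _)) (t<t+u+1 _ _))
          (∧I (∧E₁ h2) (∧I h1 (∧E₂ h3))))))))))))
    (∃ⁿI 𝟎 (⇒I (⊥E (h1 · h0))))

  from : bounded ∷ code ∷ Γ ⊩ value
  from = ⇒I (∃ⁿE h1 (∃ⁿE (h0 · h1) (∃ⁿE (∧E₂ h0) (∃ⁿI (var 1F) (∧I
    (∃ⁿI (var 6F) (∃ⁿI (var 5F) (∃ⁿI (var 4F)
      (∧I h5 (∧I (∧E₁ (∧E₂ h0)) (∃ⁿI (var 0F) (∧E₁ (∧E₂ (∧E₂ h0)))))))))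
    (∧E₂ (∧E₂ (∧E₂ h0))))))))

-- Induced V-spaces

function-unique : Γ ⊩ IsFunction π X Y →
  Γ ⊩ ⟨ t , u ⟩ ∈ π → Γ ⊩ ⟨ t , v ⟩ ∈ π → Γ ⊩ u ≈ v
function-unique f d e = ∀ⁿE* (_ ∷ _ ∷ _ ∷ []) (∧E₁ (∧E₂ f)) · ∧I d e

SameValue-sym : Γ ⊩ SameValue π t u → Γ ⊩ SameValue π u t
SameValue-sym {π = π} {t = t} {u = u} d = ∀ⁿE*
  {φ = SameValue π (var 1F) (var 0F) ⇒ SameValue π (var 0F) (var 1F)} (u ∷ t ∷ [])
  (∀ⁿI (∀ⁿI (⇒I (∃ⁿE h0 (∃ⁿI (var 0F) (∧I (∧E₂ h0) (∧E₁ h0))))))) · d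

SameValue-transfer : Γ ⊩ IsFunction π X Y →
  Γ ⊩ SameValue π t u → Γ ⊩ ⟨ t , v ⟩ ∈ π → Γ ⊩ ⟨ u , v ⟩ ∈ π
SameValue-transfer f d e = ⇒I (⇒I (⇒I (∃ⁿE h1
  (∈-resp-≈ (⟨⟩-cong ≈-refl (function-unique h3 (∧E₁ h0) h1)) (∧E₂ h0))))) · f · d · e

-- Some index exists; it is zero, or zero lies below it and belongs to the initial segment. A cover
-- can thus be defined without choosing indices.
strong-index-0 : Γ ⊩ IsStrongVSpace X I S ⇒ (∀ⁿ (var 0F ∈ X ⇒ (𝟎 ∈ I ⟦ var 0F ⟧)))
strong-index-0 = ⇒I (∀ⁿI (⇒I (cut (∀ⁿE (∧E₂ h1) (var 0F) · h0) (∃ⁿE (∧E₁ h0)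
  (∨E (zero-or-pos (var 0F))
    (∈-resp-≈ (⟨⟩-cong h0 ≈-refl) h1)
    (∀ⁿE* (𝟎 ∷ var 0F ∷ []) (∧E₁ (∧E₂ h2)) · ∧I h1 h0))))))

-- Bounding y and x by ⟨ y , x ⟩ makes the defining formula Δ₀.
first-vicinities : Γ ⊩ ∃ˢ ∀ⁿ ∀ⁿ
  (var 1F ∈ 0F ⟦ var 0F ⟧ ⇔ var 1F ∈ suc S ⟦ ⟨ var 0F , 𝟎 ⟩ ⟧)
first-vicinities {S = S} = ∃ˢE (Δ₀-comprehension
  {φ = ∃ⁿ (var 0F < var 1F + 𝟏 ∧ (∃ⁿ (var 0F < var 2F + 𝟏 ∧
    (var 2F ≈ ⟨ var 1F , var 0F ⟩ ∧ var 1F ∈ S ⟦ ⟨ var 0F , 𝟎 ⟩ ⟧))))}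
  (∃-Δ₀ (var 1F + 𝟏) (∃-Δ₀ (var 2F + 𝟏) (∧-Δ₀ ≈-Δ₀ ∈-Δ₀))))
  (∃ˢI 0F (∀ⁿI (∀ⁿI (∧I
    (⇒I (∃ⁿE (∧E₁ (∀ⁿE h1 ⟨ var 1F , var 0F ⟩) · h0) (∃ⁿE (∧E₂ h0)
      (cut (≈-sym (∧E₁ (∧E₂ h0))) (∈-resp-≈
        (⟨⟩-cong (⟨⟩-injective₁ h0) (⟨⟩-cong (⟨⟩-injective₂ h0) ≈-refl))
        (∧E₂ (∧E₂ h1)))))))
    (⇒I (∧E₂ (∀ⁿE h1 ⟨ var 1F , var 0F ⟩) ·
      ∃ⁿI (var 1F) (∧I (i<⟨i,j⟩+1 _ _)
        (∃ⁿI (var 0F) (∧I (j<⟨i,j⟩+1 _ _) (∧I ≈-refl h0))))))))))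

strong-has-cover : Γ ⊩ IsStrongVSpace X I S ⇒ (∃ˢ IsCover (suc X) (suc I) (suc S) 0F)
strong-has-cover = ⇒I (∃ˢE first-vicinities (∃ˢI 0F (∀ⁿI (⇒I (∃ⁿI 𝟎 (∧I
  (∀ⁿE (strong-index-0 · h2) (var 0F) · h0)
  (∀ⁿI (∀ⁿE* (var 1F ∷ var 0F ∷ []) h1))))))))

-- The cover picks a vicinity under some index, and the uniqueness of indices identifies it with the
-- one whose vicinity is the fibre of `π`.
cover-SameValue : Γ ⊩ IsInducedVSpace π X I S → Γ ⊩ IsCover X I S V →
  Γ ⊩ t ∈ X → Γ ⊩ u ∈ V ⟦ t ⟧ → Γ ⊩ SameValue π t u
cover-SameValue {π = π} {X = X} {V = V} {t = t} {u = u} i c d e = ∀ⁿE*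
  {φ = var 1F ∈ X ∧ (var 0F ∈ V ⟦ var 1F ⟧) ⇒ SameValue π (var 1F) (var 0F)} (u ∷ t ∷ [])
  (⇒I (⇒I (∀ⁿI (∀ⁿI (⇒I
    (∃ⁿE (∀ⁿE h1 (var 1F) · ∧E₁ h0)
      (∃ⁿE (∀ⁿE (∧E₂ h3) (var 2F) · ∧E₁ h1)
        (∧E₂ (∧E₁ (∀ⁿE (∧E₂ (∧E₂ h0)) (var 2F)) · ∈-resp-≈
          (⟨⟩-cong ≈-refl (⟨⟩-cong ≈-refl (∀ⁿE (∧E₁ (∧E₂ h0)) (var 1F) · ∧E₁ h1)))
          (∧E₁ (∀ⁿE (∧E₂ h1) (var 2F)) · ∧E₂ h2)))))))))
    · i · c)
  · ∧I d e

-- The variables 3F, 2F, 1F, 0F are x, x′, an element of both V_x and V_x′, and π(x).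
Overlap : (π X V : Fin m) → Formula n m
Overlap π X V = ∀ⁿ ∀ⁿ ∀ⁿ ∀ⁿ (var 3F ∈ X ⇒ var 2F ∈ X ⇒
  (var 1F ∈ V ⟦ var 3F ⟧) ⇒ (var 1F ∈ V ⟦ var 2F ⟧) ⇒
  ⟨ var 3F , var 0F ⟩ ∈ π ⇒ ⟨ var 2F , var 0F ⟩ ∈ π)

-- The value at `x` passes to the common element and from there to `x′`. The argument about chains
-- then sees the V-space only through `Overlap`.
cover-overlap : Γ ⊩ IsFunction π X Y ⇒ IsInducedVSpace π X I S ⇒ IsCover X I S V ⇒
  Overlap π X V
cover-overlap = ⇒I (⇒I (⇒I (∀ⁿI (∀ⁿI (∀ⁿI (∀ⁿI (⇒I (⇒I (⇒I (⇒I (⇒I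
  (SameValue-transfer h7 (SameValue-sym (cover-SameValue h6 h5 h3 h1))
    (SameValue-transfer h7 (cover-SameValue h6 h5 h4 h2) h0)))))))))))))

-- Conditions on a chain, in which the variables 0F, 1F, 2F are a code s of a
-- sequence, a value c, and the last index k of s.

Functional : Formula (3 ℕ.+ n) m
Functional = ∀ⁿ ∀ⁿ ∀ⁿ
  (var 3F at var 2F is var 1F ∧ var 3F at var 2F is var 0F ⇒ var 1F ≈ var 0F)

TermsIn : Fin m → Formula (3 ℕ.+ n) m
TermsIn X = ∀ⁿ ∀ⁿ (var 2F at var 1F is var 0F ⇒ var 0F ∈ X)

Linked : Fin m → Formula (3 ℕ.+ n) m
Linked V = ∀ⁿ (var 0F < var 3F ⇒ (∃ⁿ ∃ⁿ ∃ⁿ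
  ( var 4F at var 3F is var 2F
  ∧ var 4F at var 3F + 𝟏 is var 1F
  ∧ (var 0F ∈ V ⟦ var 2F ⟧)
  ∧ (var 0F ∈ V ⟦ var 1F ⟧))))

Propagating : Fin m → Formula (3 ℕ.+ n) m
Propagating π = ∀ⁿ ∀ⁿ (var 1F < var 4F ⇒
  var 2F at var 1F is var 0F ⇒ ⟨ var 0F , var 3F ⟩ ∈ π ⇒
  (∃ⁿ (var 3F at var 2F + 𝟏 is var 0F ∧ ⟨ var 0F , var 4F ⟩ ∈ π)))

-- The formulas standing for the membership in a code of a sequence are kept
-- abstract here, to avoid repeating their expansion throughout the derivation.
link-propagates : Γ ⊩ φ ∧ ψ ∧ (v ∈ V ⟦ t ⟧) ∧ (v ∈ V ⟦ u ⟧) →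
  Γ ⊩ (t ∈ X ⇒ u ∈ X ⇒ (v ∈ V ⟦ t ⟧) ⇒ (v ∈ V ⟦ u ⟧) ⇒
    ⟨ t , x ⟩ ∈ π ⇒ ⟨ u , x ⟩ ∈ π) →
  Γ ⊩ φ ⇒ t ∈ X → Γ ⊩ ψ ⇒ u ∈ X → Γ ⊩ χ ∧ φ ⇒ w ≈ t → Γ ⊩ χ → Γ ⊩ ⟨ w , x ⟩ ∈ π →
  Γ ⊩ ψ ∧ ⟨ u , x ⟩ ∈ π
link-propagates l o t∈X u∈X e a d = ∧I (∧E₁ (∧E₂ l))
  (o · (t∈X · ∧E₁ l) · (u∈X · ∧E₁ (∧E₂ l)) · ∧E₁ (∧E₂ (∧E₂ l)) · ∧E₂ (∧E₂ (∧E₂ l))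
    · ∈-resp-≈ (⟨⟩-cong (e · ∧I a (∧E₁ l)) ≈-refl) d)

-- Constancy of `π` along a chain

linked-propagating : Γ ⊩ Overlap π X V ⇒
  (∀ⁿ ∀ⁿ ∀ⁿ (Functional ⇒ TermsIn X ⇒ Linked V ⇒ Propagating π))
linked-propagating = ⇒I (∀ⁿI (∀ⁿI (∀ⁿI (⇒I (⇒I (⇒I (∀ⁿI (∀ⁿI (⇒I (⇒I (⇒I
  (∃ⁿE (∀ⁿE h3 (var 1F) · h2) (∃ⁿE h0 (∃ⁿE h0
    (∃ⁿI (var 1F) (link-propagates
      {v = var 0F} {t = var 2F} {u = var 1F} {x = var 6F} {w = var 3F} h0
      (∀ⁿE* (var 6F ∷ var 0F ∷ var 1F ∷ var 2F ∷ []) h9)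
      (∀ⁿE* (var 2F ∷ var 4F ∷ []) h7)
      (∀ⁿE* (var 1F ∷ var 4F + 𝟏 ∷ []) h7)
      -- The link names its own term at the index; functionality identifies it with the term whose
      -- value is known.
      (∀ⁿE* (var 2F ∷ var 3F ∷ var 4F ∷ []) h8)
      h4 h3))))))))))))))))

-- Cancelling the successors in the guard gives the strict bound that `Propagating` asks for, and
-- this implies the guard of the induction hypothesis.
SeqValue-suc : Γ ⊩ ∀ⁿ ∀ⁿ ∀ⁿ (Propagating π ⇒ (∀ⁿ (SeqValue π ⇒ SeqValue π [x+1])))
SeqValue-suc = ∀ⁿI (∀ⁿI (∀ⁿI (⇒I (∀ⁿI (⇒I (⇒I (cut (suc-cancel-< h0)
  (∃ⁿE (h2 · <⇒<suc h0)
    (∀ⁿE* (var 0F ∷ var 1F ∷ []) h4 · h1 · ∧E₁ h0 · ∧E₂ h0)))))))))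

-- The variables 3F and 4F are the first and the last term of the chain.
linked-value : Γ ⊩ Overlap π X V ⇒ (∀ⁿ ∀ⁿ ∀ⁿ ∀ⁿ ∀ⁿ
  (Functional ⇒ TermsIn X ⇒ Linked V ⇒
    var 0F at 𝟎 is var 3F ⇒ var 0F at var 2F is var 4F ⇒
    ⟨ var 3F , var 1F ⟩ ∈ π ⇒ ⟨ var 4F , var 1F ⟩ ∈ π))
linked-value = ⇒I (∀ⁿI (∀ⁿI (∀ⁿI (∀ⁿI (∀ⁿI (⇒I (⇒I (⇒I (⇒I (⇒I (⇒I (∃ⁿE
  (∀ⁿE
    (∀ⁿE* (var 0F ∷ var 1F ∷ var 2F ∷ []) SeqValue-induction
      -- The first term of the chain is a member of the code, so the code decomposes.
      · (∈ᶠ-code (var 0F) ⟨ 𝟎 , var 3F ⟩ · h2)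
      · ⇒I (∃ⁿI (var 3F) (∧I h3 h1))
      · (∀ⁿE* (var 0F ∷ var 1F ∷ var 2F ∷ []) SeqValue-suc
        · (∀ⁿE* (var 0F ∷ var 1F ∷ var 2F ∷ []) (linked-propagating · h6) · h5 · h4 · h3)))
    (var 2F) · t<t+1)
  -- `SeqValue` at the last index yields some term there with the right value; functionality
  -- identifies it with the endpoint.
  (∈-resp-≈
    (⟨⟩-cong (∀ⁿE* (var 5F ∷ var 0F ∷ var 3F ∷ []) h6 · ∧I (∧E₁ h0) h2) ≈-refl)
    (∧E₂ h0))))))))))))))

chain-value : Γ ⊩ Overlap π X V ⇒
  (∀ⁿ ∀ⁿ ∀ⁿ (HasChain X V (var 1F) (var 0F) ⇒
    ⟨ var 1F , var 2F ⟩ ∈ π ⇒ ⟨ var 0F , var 2F ⟩ ∈ π))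
chain-value = ⇒I (∀ⁿI (∀ⁿI (∀ⁿI (⇒I (∃ⁿE h0 (∃ⁿE h0
  (∀ⁿE* (var 1F ∷ var 4F ∷ var 0F ∷ var 3F ∷ var 2F ∷ []) (linked-value · h3)
    · ∧E₁ (∧E₂ (∧E₁ h0)) · ∧E₁ (∧E₂ h0) · ∧E₂ (∧E₂ (∧E₂ (∧E₂ h0)))
    · ∧E₁ (∧E₂ (∧E₂ h0)) · ∧E₁ (∧E₂ (∧E₂ (∧E₂ h0))))))))))

overlap-separates : Γ ⊩ IsFunction π X Y ⇒ Overlap π X V ⇒
  (∀ⁿ ∀ⁿ (DifferentValues π (var 1F) (var 0F) ⇒ ¬ HasChain X V (var 1F) (var 0F)))
overlap-separates = ⇒I (⇒I (∀ⁿI (∀ⁿI (⇒I (⇒I (∃ⁿE h1 (∃ⁿE h0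
  (∧E₂ (∧E₂ h0) · function-unique h5
    (∀ⁿE* (var 2F ∷ var 3F ∷ var 1F ∷ []) (chain-value · h4) · h2 · ∧E₁ h0)
    (∧E₁ (∧E₂ h0))))))))))

-- Connectedness quantifies over all covers, so the single cover from `strong-has-cover` refutes it.
induced-not-connected : Γ ⊩ IsFunction π X Y ⇒ IsInducedVSpace π X I S ⇒
  (∀ⁿ ∀ⁿ (DifferentValues π (var 1F) (var 0F) ⇒ ¬ Connected X I S (var 1F) (var 0F)))
induced-not-connected = ⇒I (⇒I (∃ˢE (strong-has-cover · ∧E₁ h0)
  (cut (overlap-separates · h2 · (cover-overlap · h2 · h1 · h0))
    (∀ⁿI (∀ⁿI (⇒I (⇒I
      (∀ⁿE* (var 0F ∷ var 1F ∷ []) h2 · h1 · (∀ˢE h0 0F · h3)))))))))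

theorem2p5 : RCA₀ ⊢ (∀ˢ ∀ˢ ∀ˢ (IsFunction 0F 2F 1F ⇒
    (∀ⁿ ∀ⁿ (var 1F ∈ 2F ∧ var 0F ∈ 2F ∧ DifferentValues 0F (var 1F) (var 0F) ⇒
    (∀ˢ ∀ˢ (IsInducedVSpace 2F 4F 1F 0F ⇒
    ¬ Connected 4F 1F 0F (var 1F) (var 0F)))))))
theorem2p5 = ∀ˢI (∀ˢI (∀ˢI (⇒I (∀ⁿI (∀ⁿI (⇒I (∀ˢI (∀ˢI (⇒I
  (∀ⁿE* (var 0F ∷ var 1F ∷ []) (induced-not-connected · h2 · h0) · ∧E₂ (∧E₂ h1)))))))))))
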